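{- The Euler totient function $(\varphi(n))_{n\geq 1}$ is not $k$-regular for any integer $k\geq 2$.
   Context: An integer sequence $(s(n))$ is $k$-regular if its $k$-kernel $\{(s(k^l n+r))_{n}: l\geq 0,\ 0\leq r<k^l\}$ is contained in the $\mathbb{Z}$-linear span of finitely many integer sequences. -}

module Defs where

open import Data.Nat using (ℕ; zero; suc; _+_; _*_; _^_; _<_)
open import Data.Nat.GCD using (gcd)
open import Data.Nat.Coprimality using (Coprime; coprime?)
open import Data.List using (List; length; filter; upTo; map)
open import Data.Integer using (ℤ) renaming (_+_ to _+ℤ_; _*_ to _*ℤ_)
import Data.Integer as ℤ
open import Data.Fin using (Fin)
open import Data.Product using (Σ; ∃; ∃-syntax)
open import Relation.Binary.PropositionalEquality using (_≡_)

φ : ℕ → ℕ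
φ n = length (filter (λ m → coprime? m n) (map suc (upTo n)))

lincomb : (d : ℕ) → (Fin d → ℤ) → (Fin d → ℕ → ℤ) → ℕ → ℤ
lincomb zero    c t n = ℤ.+ 0
lincomb (suc d) c t n = (c Fin.zero *ℤ t Fin.zero n) +ℤ lincomb d (λ i → c (Fin.suc i)) (λ i → t (Fin.suc i)) n
  where import Data.Fin as Fin

-- s is k-regular: the k-kernel { n ↦ s (k^l * n + r) : l ≥ 0, 0 ≤ r < k^l }
-- lies in the ℤ-span of finitely many integer sequences t 0, …, t (d-1).
IsRegular : ℕ → (ℕ → ℤ) → Set
IsRegular k s =
  Σ ℕ λ d → Σ (Fin d → ℕ → ℤ) λ t → ((l r : ℕ) → r < k ^ l →
     Σ (Fin d → ℤ) λ c → ((n : ℕ) → s (k ^ l * n + r) ≡ lincomb d c t n))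

-- the totient sequence as an integer sequence; entry 0 is φ 0 = 0 (convention),
-- entries n ≥ 1 are Euler's φ(n)
φseq : ℕ → ℤ
φseq n = ℤ.+ (φ n)

{-# OPTIONS --safe #-}

-- Modulo 2 ^ M a k-regular sequence has only finitely many kernel sequences,
-- so with q = 1 + 2k there are exponents a < b for which φ (k^l n + q^a) and
-- φ (k^l n + q^b) agree modulo 2 ^ M for all n. Whenever k^l ∣ q^u - 1, some n
-- makes the first argument q^(a+u) and the second q^a (q^u + c), where
-- 1 + c = q^(b-a). For u ≥ 1 the 2-adic valuation of φ (q^(a+u)) is that of φ q,
-- which is below M for M = q, whereas that of φ (q^u + c) can be made as large as
-- desired: if A = q^u + c and q^T ≡ 1 modulo k^l A², then
-- q^(u+T) + c = A (1 + A w), and φ (1 + A w) is even.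
module Submission where

open import Defs
open import Data.Nat
open import Data.Nat.Properties
open import Data.Nat.Coprimality using (Coprime; coprime?; coprime-divisor)
  renaming (sym to coprime-sym)
open import Data.Nat.Divisibility
open import Data.Nat.DivMod
open import Data.Nat.Tactic.RingSolver using (solve-∀)
import Data.Integer as ℤ
import Data.Integer.DivMod as ℤ
import Data.Integer.Divisibility.Signed as ℤ∣
import Data.Integer.Tactic.RingSolver as ℤSolver
open import Data.Bool using (if_then_else_)
open import Data.Fin as Fin using (Fin; toℕ; fromℕ<; funToFin; finToFun)
open import Data.Fin.Properties
  using (pigeonhole; finToFun-funToFin; toℕ-injective; toℕ-fromℕ<; toℕ<n)
open import Data.Fin.Permutation using (Permutation; permutation)
open import Data.List using (length; filter; upTo; map; applyUpTo)
open import Data.List.Properties using (length-filter; length-map; length-upTo)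
open import Data.Product using (∃; ∃₂; _×_; _,_; proj₁; proj₂)
open import Function using (_∘_; it)
open import Relation.Nullary using (¬_; Dec; yes; no; does)
open import Relation.Nullary.Decidable using (dec-true; dec-false)
open import Relation.Unary using (Decidable)
open import Relation.Binary.PropositionalEquality
open import Algebra.Properties.Semiring.Sum +-*-semiring
  using (sum; sum-cong-≗; *-distribʳ-sum; ∑-comm; sum-permute)

-- Coprimality and powers

-- A common divisor `d` of `m` and `n * o` shares no factor with `n`, since that factor would also
-- divide `m`; hence `d` divides `o`.
coprime-*ʳ : ∀ {m n o} → Coprime m n → Coprime m o → Coprime m (n * o)
coprime-*ʳ m⊥n m⊥o (d∣m , d∣no) =
  m⊥o (d∣m , coprime-divisor (λ (e∣d , e∣n) → m⊥n (∣-trans e∣d d∣m , e∣n)) d∣no)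

coprime-∣ʳ : ∀ {m n o} → n ∣ o → Coprime m o → Coprime m n
coprime-∣ʳ n∣o m⊥o (d∣m , d∣n) = m⊥o (d∣m , ∣-trans d∣n n∣o)

coprime-^ʳ : ∀ {m n} → Coprime m n → ∀ e → Coprime m (n ^ e)
coprime-^ʳ m⊥n zero    (_ , d∣1) = ∣1⇒≡1 d∣1
coprime-^ʳ m⊥n (suc e) = coprime-*ʳ m⊥n (coprime-^ʳ m⊥n e)

coprime-1+* : ∀ m n → Coprime m (1 + m * n)
coprime-1+* m n {d} (d∣m , d∣1+mn) =
  ∣1⇒≡1 (∣m+n∣m⇒∣n (subst (d ∣_) (+-comm 1 (m * n)) d∣1+mn) (∣m⇒∣m*n n d∣m))

n<m^n : ∀ m n → 2 ≤ m → n < m ^ n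
n<m^n m zero    2≤m = s≤s z≤n
n<m^n m (suc n) 2≤m = begin-strict
  suc n         <⟨ s≤s (n<m^n m n 2≤m) ⟩
  1 + m ^ n     ≤⟨ +-monoˡ-≤ (m ^ n) (≤-trans (s≤s z≤n) (n<m^n m n 2≤m)) ⟩
  m ^ n + m ^ n ≡⟨ cong (m ^ n +_) (sym (+-identityʳ _)) ⟩
  2 * m ^ n     ≤⟨ *-monoˡ-≤ (m ^ n) 2≤m ⟩
  m * m ^ n     ∎
  where open ≤-Reasoning

[a+b]%n≡a%n⇒n∣b : ∀ a b n .{{_ : NonZero n}} → (a + b) % n ≡ a % n → n ∣ b
[a+b]%n≡a%n⇒n∣b a b n eq =
  ∣m+n∣m⇒∣n (subst (n ∣_) (sym qn+b≡q′n) (n∣m*n ((a + b) / n))) (n∣m*n (a / n))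
  where
  open ≡-Reasoning
  qn+b≡q′n : a / n * n + b ≡ (a + b) / n * n
  qn+b≡q′n = +-cancelˡ-≡ (a % n) _ _ (begin
    a % n + (a / n * n + b)           ≡⟨ sym (+-assoc (a % n) _ b) ⟩
    a % n + a / n * n + b             ≡⟨ cong (_+ b) (sym (m≡m%n+[m/n]*n a n)) ⟩
    a + b                             ≡⟨ m≡m%n+[m/n]*n (a + b) n ⟩
    (a + b) % n + (a + b) / n * n     ≡⟨ cong (_+ (a + b) / n * n) eq ⟩
    a % n + (a + b) / n * n           ∎)

-- Two of the powers `x ^ 0`, ..., `x ^ n` agree modulo `n` by the pigeonhole principle, and the
-- smaller one cancels because it is coprime to `n`. The exponent has the form `suc t` so that
-- `x ^ t` is an inverse of `x` modulo `n`.
power≡1 : ∀ x n .{{_ : NonZero x}} .{{_ : NonZero n}} → Coprime x n →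
          ∃₂ λ t y → x ^ suc t ≡ 1 + n * y
power≡1 x n x⊥n
  with i , j , i<j , eq ← pigeonhole (n<1+n n) (λ i → x ^ toℕ i mod n)
  with t , i+t≡j ← m≤n⇒∃[o]m+o≡n i<j
  -- The power is positive; naming it `suc p` turns the congruence to 1 into `n ∣ p`, with no
  -- subtraction.
  with x ^ suc t in xᵗ | m^n>0 x (suc t)
... | suc p | _ = t , quotient n∣p , trans xᵗ (cong suc (m∣n⇒n≡m*quotient n∣p))
  where
  open ≡-Reasoning
  split : x ^ toℕ j ≡ x ^ toℕ i + x ^ toℕ i * p
  split = begin
    x ^ toℕ j                  ≡⟨ cong (x ^_) (trans (sym i+t≡j) (sym (+-suc (toℕ i) t))) ⟩
    x ^ (toℕ i + suc t)        ≡⟨ ^-distribˡ-+-* x (toℕ i) (suc t) ⟩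
    x ^ toℕ i * x ^ suc t      ≡⟨ cong (x ^ toℕ i *_) xᵗ ⟩
    x ^ toℕ i * suc p          ≡⟨ *-suc (x ^ toℕ i) p ⟩
    x ^ toℕ i + x ^ toℕ i * p  ∎
  same% : (x ^ toℕ i + x ^ toℕ i * p) % n ≡ x ^ toℕ i % n
  same% = begin
    (x ^ toℕ i + x ^ toℕ i * p) % n  ≡⟨ cong (_% n) (sym split) ⟩
    x ^ toℕ j % n                    ≡⟨ sym (toℕ-fromℕ< _) ⟩
    toℕ (x ^ toℕ j mod n)            ≡⟨ cong toℕ (sym eq) ⟩
    toℕ (x ^ toℕ i mod n)            ≡⟨ toℕ-fromℕ< _ ⟩
    x ^ toℕ i % n                    ∎
  n∣p : n ∣ p
  n∣p = coprime-divisor (coprime-^ʳ (coprime-sym x⊥n) (toℕ i))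
          ([a+b]%n≡a%n⇒n∣b _ _ n same%)

-- Sums over initial segments of ℕ

∑< : ℕ → (ℕ → ℕ) → ℕ
∑< n f = sum {n} (f ∘ toℕ)

∑<-cong : ∀ n {f g : ℕ → ℕ} → (∀ i → f i ≡ g i) → ∑< n f ≡ ∑< n g
∑<-cong n f≗g = sum-cong-≗ {n} (f≗g ∘ toℕ)

∑<-+ : ∀ m n f → ∑< (m + n) f ≡ ∑< m f + ∑< n (f ∘ (m +_))
∑<-+ zero    n f = refl
∑<-+ (suc m) n f =
  trans (cong (f 0 +_) (∑<-+ m n (f ∘ suc))) (sym (+-assoc (f 0) _ _))

∑<-last : ∀ n f → ∑< (suc n) f ≡ ∑< n f + f n
∑<-last zero    f = +-identityʳ (f 0)
∑<-last (suc n) f =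
  trans (cong (f 0 +_) (∑<-last n (f ∘ suc))) (sym (+-assoc (f 0) _ _))

∑<-* : ∀ m n f → ∑< (m * n) f ≡ ∑< m (λ j → ∑< n (λ r → f (j * n + r)))
∑<-* zero    n f = refl
∑<-* (suc m) n f = begin
  ∑< (n + m * n) f
    ≡⟨ ∑<-+ n (m * n) f ⟩
  ∑< n f + ∑< (m * n) (f ∘ (n +_))
    ≡⟨ cong (∑< n f +_) (∑<-* m n (f ∘ (n +_))) ⟩
  ∑< n f + ∑< m (λ j → ∑< n (λ r → f (n + (j * n + r))))
    ≡⟨ cong (∑< n f +_) (∑<-cong m λ j → ∑<-cong n λ r → cong f (sym (+-assoc n (j * n) r))) ⟩
  ∑< n f + ∑< m (λ j → ∑< n (λ r → f (n + j * n + r))) ∎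
  where open ≡-Reasoning

∑<-const : ∀ n c → ∑< n (λ _ → c) ≡ n * c
∑<-const zero    c = refl
∑<-const (suc n) c = cong (c +_) (∑<-const n c)

-- Stripping the two equal outer terms removes `2 * f 0` and leaves a shorter palindrome. For odd
-- `n` the recursion ends at the middle term, which has to vanish.
∑<-palindrome-even : ∀ n f → (∀ i j → suc (i + j) ≡ n → f i ≡ f j) →
                     (∀ i → suc (i + i) ≡ n → f i ≡ 0) → 2 ∣ ∑< n f
∑<-palindrome-even 0             f f-sym f-mid = 2 ∣0
∑<-palindrome-even 1             f f-sym f-mid rewrite f-mid 0 refl = 2 ∣0
∑<-palindrome-even (suc (suc n)) f f-sym f-mid =
  subst (2 ∣_) (sym split) (∣m∣n⇒∣m+n (m∣m*n (f 0)) inner)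
  where
  open ≡-Reasoning
  shift : ∀ {i j} → suc (i + j) ≡ n → suc (suc i + suc j) ≡ suc (suc n)
  shift {i} {j} eq = cong (suc ∘ suc) (trans (+-suc i j) eq)
  inner : 2 ∣ ∑< n (f ∘ suc)
  inner = ∑<-palindrome-even n (f ∘ suc)
            (λ i j eq → f-sym (suc i) (suc j) (shift eq)) (λ i eq → f-mid (suc i) (shift eq))
  split : f 0 + ∑< (suc n) (f ∘ suc) ≡ 2 * f 0 + ∑< n (f ∘ suc)
  split = begin
    f 0 + ∑< (suc n) (f ∘ suc)
      ≡⟨ cong (f 0 +_) (∑<-last n (f ∘ suc)) ⟩
    f 0 + (∑< n (f ∘ suc) + f (suc n))
      ≡⟨ cong (λ z → f 0 + (∑< n (f ∘ suc) + z)) (sym (f-sym 0 (suc n) refl)) ⟩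
    f 0 + (∑< n (f ∘ suc) + f 0)
      ≡⟨ rearrange (f 0) (∑< n (f ∘ suc)) ⟩
    2 * f 0 + ∑< n (f ∘ suc) ∎
    where
    rearrange : ∀ a b → a + (b + a) ≡ 2 * a + b
    rearrange = solve-∀

-- Sums of periodic functions over a full period

Periodic : ℕ → (ℕ → ℕ) → Set
Periodic n f = ∀ i → f (i + n) ≡ f i

module _ {n f} (periodic : Periodic n f) where

  periodic-* : ∀ i k → f (i + k * n) ≡ f i
  periodic-* i zero    = cong f (+-identityʳ i)
  periodic-* i (suc k) =
    trans (cong f (sym (+-assoc i n (k * n)))) (trans (periodic-* (i + n) k) (periodic i))

  periodic-% : .{{_ : NonZero n}} → ∀ i → f (i % n) ≡ f i
  periodic-% i = trans (sym (periodic-* (i % n) (i / n))) (cong f (sym (m≡m%n+[m/n]*n i n)))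

  -- Moving the window by one place drops `f r` and gains `f (n + r)`, equal to it by periodicity.
  -- The two windows are compared after adding `f r` to both.
  ∑<-shift : ∀ r → ∑< n (λ i → f (i + r)) ≡ ∑< n f
  ∑<-shift zero    = ∑<-cong n λ i → cong f (+-identityʳ i)
  ∑<-shift (suc r) = trans (+-cancelˡ-≡ (f r) _ _ (begin
    f r + ∑< n (λ i → f (i + suc r))
      ≡⟨ cong (f r +_) (∑<-cong n λ i → cong f (+-suc i r)) ⟩
    ∑< (suc n) (λ i → f (i + r))
      ≡⟨ ∑<-last n (λ i → f (i + r)) ⟩
    ∑< n (λ i → f (i + r)) + f (n + r)
      ≡⟨ cong (∑< n (λ i → f (i + r)) +_) (trans (cong f (+-comm n r)) (periodic r)) ⟩
    ∑< n (λ i → f (i + r)) + f r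
      ≡⟨ +-comm _ (f r) ⟩
    f r + ∑< n (λ i → f (i + r)) ∎)) (∑<-shift r)
    where open ≡-Reasoning

*-%-cong : ∀ x a n .{{_ : NonZero n}} → (x * (a % n)) % n ≡ (x * a) % n
*-%-cong x a n = begin
  (x * (a % n)) % n                    ≡⟨ sym ([m+kn]%n≡m%n _ (x * (a / n)) n) ⟩
  (x * (a % n) + x * (a / n) * n) % n  ≡⟨ cong (_% n) (factor x (a % n) (a / n) n) ⟩
  (x * (a % n + a / n * n)) % n        ≡⟨ cong (λ z → (x * z) % n) (sym (m≡m%n+[m/n]*n a n)) ⟩
  (x * a) % n                          ∎
  where
  open ≡-Reasoning
  factor : ∀ x r q n → x * r + x * q * n ≡ x * (r + q * n)
  factor = solve-∀

-- Used with `x` and `x′` in either order, this gives both inverse laws of the permutation in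
-- `∑<-scale`.
mod-*-inverse : ∀ x x′ z n .{{_ : NonZero n}} → x * x′ ≡ 1 + n * z →
                ∀ (j : Fin n) → (x * toℕ ((x′ * toℕ j) mod n)) mod n ≡ j
mod-*-inverse x x′ z n eq j = toℕ-injective (begin
  toℕ ((x * toℕ ((x′ * toℕ j) mod n)) mod n)  ≡⟨ toℕ-fromℕ< _ ⟩
  (x * toℕ ((x′ * toℕ j) mod n)) % n          ≡⟨ cong (λ i → (x * i) % n) (toℕ-fromℕ< _) ⟩
  (x * ((x′ * toℕ j) % n)) % n                ≡⟨ *-%-cong x (x′ * toℕ j) n ⟩
  (x * (x′ * toℕ j)) % n                      ≡⟨ cong (_% n) (sym (*-assoc x x′ (toℕ j))) ⟩
  (x * x′ * toℕ j) % n                        ≡⟨ cong (λ i → (i * toℕ j) % n) eq ⟩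
  ((1 + n * z) * toℕ j) % n                   ≡⟨ cong (_% n) (expand n z (toℕ j)) ⟩
  (toℕ j + z * toℕ j * n) % n                 ≡⟨ [m+kn]%n≡m%n (toℕ j) (z * toℕ j) n ⟩
  toℕ j % n                                   ≡⟨ m<n⇒m%n≡m (toℕ<n j) ⟩
  toℕ j                                       ∎)
  where
  open ≡-Reasoning
  expand : ∀ n z j → (1 + n * z) * j ≡ j + z * j * n
  expand = solve-∀

-- Multiplication by a unit permutes the residues modulo `n`; `power≡1` supplies the inverse
-- `x ^ t`.
∑<-scale : ∀ {n f} → Periodic n f → ∀ x .{{_ : NonZero x}} .{{_ : NonZero n}} → Coprime x n →
           ∑< n (λ j → f (j * x)) ≡ ∑< n f
∑<-scale {n} {f} periodic x x⊥n with t , z , eq ← power≡1 x n x⊥n =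
  sym (trans (sum-permute (f ∘ toℕ) π) (sum-cong-≗ {n} λ j → begin
    f (toℕ ((x * toℕ j) mod n))  ≡⟨ cong f (toℕ-fromℕ< _) ⟩
    f ((x * toℕ j) % n)          ≡⟨ periodic-% periodic (x * toℕ j) ⟩
    f (x * toℕ j)                ≡⟨ cong f (*-comm x (toℕ j)) ⟩
    f (toℕ j * x)                ∎))
  where
  open ≡-Reasoning
  π : Permutation n n
  π = permutation (λ j → (x * toℕ j) mod n) (λ j → (x ^ t * toℕ j) mod n)
        (mod-*-inverse x (x ^ t) z n eq)
        (mod-*-inverse (x ^ t) x z n (trans (*-comm (x ^ t) x) eq))

-- Euler's totient

indicator : ∀ {P : Set} → Dec P → ℕ
indicator P? = if does P? then 1 else 0

indicator-yes : ∀ {P : Set} (P? : Dec P) → P → indicator P? ≡ 1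
indicator-yes P? p = cong (if_then 1 else 0) (dec-true P? p)

indicator-no : ∀ {P : Set} (P? : Dec P) → ¬ P → indicator P? ≡ 0
indicator-no P? ¬p = cong (if_then 1 else 0) (dec-false P? ¬p)

-- `upTo` is `applyUpTo` of the identity; a general `g` is needed because the recursion replaces `g`
-- by `g ∘ suc`.
length-filter-applyUpTo : ∀ {P : ℕ → Set} (P? : Decidable P) (g : ℕ → ℕ) n →
  length (filter P? (map suc (applyUpTo g n))) ≡ ∑< n (λ i → indicator (P? (suc (g i))))
length-filter-applyUpTo P? g zero    = refl
length-filter-applyUpTo P? g (suc n) with P? (suc (g 0))
... | yes _ = cong suc (length-filter-applyUpTo P? (g ∘ suc) n)
... | no _  = length-filter-applyUpTo P? (g ∘ suc) n

-- Opaque, as unfolding the decision procedure makes unification intractable.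
opaque
  χ : ℕ → ℕ → ℕ
  χ m n = indicator (coprime? m n)

  χ-coprime : ∀ {m n} → Coprime m n → χ m n ≡ 1
  χ-coprime {m} {n} m⊥n = indicator-yes (coprime? m n) (λ {e} → m⊥n {e})

  χ-¬coprime : ∀ {m n} → ¬ Coprime m n → χ m n ≡ 0
  χ-¬coprime {m} {n} ¬m⊥n = indicator-no (coprime? m n) ¬m⊥n

  φ-∑ : ∀ n → φ n ≡ ∑< n (λ i → χ (suc i) n)
  φ-∑ n = length-filter-applyUpTo (λ i → coprime? i n) (λ i → i) n

χ-cong : ∀ {a b c d} → (Coprime a b → Coprime c d) → (Coprime c d → Coprime a b) →
         χ a b ≡ χ c d
χ-cong {a} {b} {c} {d} to from = by-cases (coprime? a b)
  where
  by-cases : Dec (Coprime a b) → χ a b ≡ χ c d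
  by-cases (yes a⊥b) = trans (χ-coprime {a} a⊥b) (sym (χ-coprime {c} (to a⊥b)))
  by-cases (no ¬a⊥b) =
    trans (χ-¬coprime {a} ¬a⊥b) (sym (χ-¬coprime {c} λ c⊥d → ¬a⊥b λ {e} → from c⊥d {e}))

χ-* : ∀ i m n → χ i (m * n) ≡ χ i m * χ i n
χ-* i m n = by-cases (coprime? i m) (coprime? i n)
  where
  by-cases : Dec (Coprime i m) → Dec (Coprime i n) → χ i (m * n) ≡ χ i m * χ i n
  by-cases (yes i⊥m) (yes i⊥n) =
    trans (χ-coprime {i} (λ {e} → coprime-*ʳ i⊥m i⊥n {e}))
      (sym (cong₂ _*_ (χ-coprime {i} i⊥m) (χ-coprime {i} i⊥n)))
  by-cases _ (no ¬i⊥n) =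
    trans (χ-¬coprime {i} λ c → ¬i⊥n λ {e} → coprime-∣ʳ (n∣m*n m) c {e})
      (sym (trans (cong (χ i m *_) (χ-¬coprime {i} ¬i⊥n)) (*-zeroʳ (χ i m))))
  by-cases (no ¬i⊥m) _ =
    trans (χ-¬coprime {i} λ c → ¬i⊥m λ {e} → coprime-∣ʳ (m∣m*n n) c {e})
      (sym (cong (_* χ i n) (χ-¬coprime {i} ¬i⊥m)))

χ-periodic : ∀ n → Periodic n (λ i → χ i n)
χ-periodic n i = χ-cong
  (λ c {_} (d∣i , d∣n) → c (∣m∣n⇒∣m+n d∣i d∣n , d∣n))
  (λ c {d} (d∣i+n , d∣n) → c (∣m+n∣m⇒∣n (subst (d ∣_) (+-comm i n) d∣i+n) d∣n , d∣n))

-- By periodicity the window from 1 to `n` can be exchanged for the one from 0 to `n - 1`, which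
-- suits division with remainder.
φ-∑₀ : ∀ n → φ n ≡ ∑< n (λ i → χ i n)
φ-∑₀ n = begin
  φ n                         ≡⟨ φ-∑ n ⟩
  ∑< n (λ i → χ (suc i) n)    ≡⟨ ∑<-cong n (λ i → cong (λ j → χ j n) (+-comm 1 i)) ⟩
  ∑< n (λ i → χ (i + 1) n)    ≡⟨ ∑<-shift (χ-periodic n) 1 ⟩
  ∑< n (λ i → χ i n)          ∎
  where open ≡-Reasoning

-- Arrange the residues modulo `m * n` as `j * m + r`. Coprimality to `m` depends on `r` alone, and
-- for fixed `r` the entries run through all residues modulo `n` as `j` varies, because `m` is a
-- unit there. Each column thus contributes `χ r m * φ n`.
φ-* : ∀ m n .{{_ : NonZero m}} .{{_ : NonZero n}} → Coprime m n → φ (m * n) ≡ φ m * φ n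
φ-* m n m⊥n = begin
  φ (m * n)
    ≡⟨ φ-∑₀ (m * n) ⟩
  ∑< (m * n) (λ i → χ i (m * n))
    ≡⟨ cong (λ k → ∑< k (λ i → χ i (m * n))) (*-comm m n) ⟩
  ∑< (n * m) (λ i → χ i (m * n))
    ≡⟨ ∑<-* n m (λ i → χ i (m * n)) ⟩
  ∑< n (λ j → ∑< m (λ r → χ (j * m + r) (m * n)))
    ≡⟨ ∑-comm (λ (j : Fin n) (r : Fin m) → χ (toℕ j * m + toℕ r) (m * n)) ⟩
  ∑< m (λ r → ∑< n (λ j → χ (j * m + r) (m * n)))
    ≡⟨ ∑<-cong m (λ r → column r) ⟩
  ∑< m (λ r → χ r m * φ n)
    ≡⟨ sym (*-distribʳ-sum {m} (φ n) (λ r → χ (toℕ r) m)) ⟩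
  ∑< m (λ r → χ r m) * φ n
    ≡⟨ cong (_* φ n) (sym (φ-∑₀ m)) ⟩
  φ m * φ n ∎
  where
  open ≡-Reasoning
  entry : ∀ r j → χ (j * m + r) (m * n) ≡ χ (j * m + r) n * χ r m
  entry r j = begin
    χ (j * m + r) (m * n)            ≡⟨ χ-* (j * m + r) m n ⟩
    χ (j * m + r) m * χ (j * m + r) n  ≡⟨ *-comm _ (χ (j * m + r) n) ⟩
    χ (j * m + r) n * χ (j * m + r) m  ≡⟨ cong (λ i → χ (j * m + r) n * χ i m) (+-comm (j * m) r) ⟩
    χ (j * m + r) n * χ (r + j * m) m
      ≡⟨ cong (χ (j * m + r) n *_) (periodic-* (χ-periodic m) r j) ⟩
    χ (j * m + r) n * χ r m          ∎
  shifted : ∀ r → Periodic n (λ i → χ (i + r) n)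
  shifted r i = trans (cong (λ k → χ k n) (swap i n r)) (χ-periodic n (i + r))
    where
    swap : ∀ i n r → i + n + r ≡ i + r + n
    swap = solve-∀
  column : ∀ r → ∑< n (λ j → χ (j * m + r) (m * n)) ≡ χ r m * φ n
  column r = begin
    ∑< n (λ j → χ (j * m + r) (m * n))
      ≡⟨ ∑<-cong n (entry r) ⟩
    ∑< n (λ j → χ (j * m + r) n * χ r m)
      ≡⟨ sym (*-distribʳ-sum {n} (χ r m) (λ j → χ (toℕ j * m + r) n)) ⟩
    ∑< n (λ j → χ (j * m + r) n) * χ r m
      ≡⟨ cong (_* χ r m) (∑<-scale (shifted r) m m⊥n) ⟩
    ∑< n (λ j → χ (j + r) n) * χ r m
      ≡⟨ cong (_* χ r m) (∑<-shift (χ-periodic n) r) ⟩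
    ∑< n (λ j → χ j n) * χ r m
      ≡⟨ cong (_* χ r m) (sym (φ-∑₀ n)) ⟩
    φ n * χ r m
      ≡⟨ *-comm (φ n) (χ r m) ⟩
    χ r m * φ n ∎

-- When `m` divides `n`, being coprime to `m * n` is the same as being coprime to `n`, so the sum
-- consists of `m` full periods.
φ-*-∣ : ∀ m n → m ∣ n → φ (m * n) ≡ m * φ n
φ-*-∣ m n m∣n = begin
  φ (m * n)
    ≡⟨ φ-∑₀ (m * n) ⟩
  ∑< (m * n) (λ i → χ i (m * n))
    ≡⟨ ∑<-* m n (λ i → χ i (m * n)) ⟩
  ∑< m (λ j → ∑< n (λ r → χ (j * n + r) (m * n)))
    ≡⟨ ∑<-cong m (λ j → ∑<-cong n (entry j)) ⟩
  ∑< m (λ _ → ∑< n (λ r → χ r n))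
    ≡⟨ ∑<-const m _ ⟩
  m * ∑< n (λ r → χ r n)
    ≡⟨ cong (m *_) (sym (φ-∑₀ n)) ⟩
  m * φ n ∎
  where
  open ≡-Reasoning
  entry : ∀ j r → χ (j * n + r) (m * n) ≡ χ r n
  entry j r = begin
    χ (j * n + r) (m * n)
      ≡⟨ χ-cong (λ c {e} → coprime-∣ʳ (n∣m*n m) c {e})
                (λ c {e} → coprime-*ʳ (λ {e} → coprime-∣ʳ m∣n c {e}) c {e}) ⟩
    χ (j * n + r) n  ≡⟨ cong (λ i → χ i n) (+-comm (j * n) r) ⟩
    χ (r + j * n) n  ≡⟨ periodic-* (χ-periodic n) r j ⟩
    χ r n            ∎

φ-^ : ∀ m e → φ (m ^ suc e) ≡ m ^ e * φ m
φ-^ m zero    = trans (cong φ (*-identityʳ m)) (sym (*-identityˡ (φ m)))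
φ-^ m (suc e) = begin
  φ (m * m ^ suc e)  ≡⟨ φ-*-∣ m (m ^ suc e) (m∣m*n (m ^ e)) ⟩
  m * φ (m ^ suc e)  ≡⟨ cong (m *_) (φ-^ m e) ⟩
  m * (m ^ e * φ m)  ≡⟨ sym (*-assoc m (m ^ e) (φ m)) ⟩
  m ^ suc e * φ m    ∎
  where open ≡-Reasoning

φ≤n : ∀ n → φ n ≤ n
φ≤n n = ≤-trans (length-filter (λ i → coprime? i n) (map suc (upTo n)))
          (≤-reflexive (trans (length-map suc (upTo n)) (length-upTo n)))

φ>0 : ∀ n .{{_ : NonZero n}} → 0 < φ n
φ>0 n@(suc _) = subst (0 <_) (sym (φ-∑ n))
  (≤-trans (≤-reflexive (sym (χ-coprime {1} {n} λ (d∣1 , _) → ∣1⇒≡1 d∣1))) (m≤m+n (χ 1 n) _))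

-- The units i and n - i are distinct, as n / 2 is not a unit for n ≥ 3.
φ-even : ∀ n → 3 ≤ n → 2 ∣ φ n
φ-even n@(suc n-1) 3≤n = subst (2 ∣_) (sym φ≡) (∑<-palindrome-even n-1 (λ i → χ (suc i) n)
  (λ i j eq → χ-cong (λ c {e} → reflect i j eq c {e})
                     (λ c {e} → reflect j i (trans (cong suc (+-comm j i)) eq) c {e}))
  (λ i eq → χ-¬coprime {suc i} {n} λ c → middle i eq (c (∣-refl , half i eq))))
  where
  complement : ∀ i j → suc (i + j) ≡ n-1 → suc i + suc j ≡ n
  complement i j eq = cong suc (trans (+-suc i j) eq)
  reflect : ∀ i j → suc (i + j) ≡ n-1 → Coprime (suc i) n → Coprime (suc j) n
  reflect i j eq c {d} (d∣j , d∣n) =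
    c (∣m+n∣m⇒∣n (subst (d ∣_) (trans (sym (complement i j eq)) (+-comm (suc i) (suc j))) d∣n) d∣j
      , d∣n)
  half : ∀ i → suc (i + i) ≡ n-1 → suc i ∣ n
  half i eq = subst (suc i ∣_) (complement i i eq) (∣m∣n⇒∣m+n ∣-refl ∣-refl)
  middle : ∀ i → suc (i + i) ≡ n-1 → suc i ≢ 1
  middle i eq refl = <-irrefl (complement 0 0 eq) 3≤n
  -- The last term `χ n n` vanishes; what remains is symmetric under negation modulo `n`.
  φ≡ : φ n ≡ ∑< n-1 (λ i → χ (suc i) n)
  φ≡ = begin
    φ n                                           ≡⟨ φ-∑ n ⟩
    ∑< n (λ i → χ (suc i) n)                      ≡⟨ ∑<-last n-1 (λ i → χ (suc i) n) ⟩
    ∑< n-1 (λ i → χ (suc i) n) + χ n n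
      ≡⟨ cong (∑< n-1 (λ i → χ (suc i) n) +_) (χ-¬coprime {n} {n} n⊥̸n) ⟩
    ∑< n-1 (λ i → χ (suc i) n) + 0                ≡⟨ +-identityʳ _ ⟩
    ∑< n-1 (λ i → χ (suc i) n)                    ∎
    where
    open ≡-Reasoning
    n⊥̸n : ¬ Coprime n n
    n⊥̸n c = <-irrefl (sym (c (∣-refl , ∣-refl))) (≤-trans (s≤s (s≤s z≤n)) 3≤n)

-- Totients of shifted powers

coprime-^+ : ∀ q u c → q ∣ suc c → Coprime q (q ^ suc u + c)
coprime-^+ q u c q∣1+c {d} (d∣q , d∣qᵘ+c) =
  ∣1⇒≡1 (∣m+n∣m⇒∣n
    (subst (d ∣_) (+-comm 1 c) (∣-trans d∣q q∣1+c))
    (∣m+n∣m⇒∣n d∣qᵘ+c (∣m⇒∣m*n (q ^ u) d∣q)))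

-- Induction on `M`: each round lengthens the exponent so that the old value `A` splits off from the
-- new one with a coprime cofactor of even totient. The hypothesis `q ∣ suc c` makes `A` coprime to
-- `q`, so that `power≡1` applies again.
2^∣φ[q^u+c] : ∀ q B c .{{_ : NonZero B}} → 2 ≤ q → Coprime q B → q ∣ suc c → ∀ M →
              ∃₂ λ u y → q ^ suc u ≡ 1 + B * y × 2 ^ M ∣ φ (q ^ suc u + c)
2^∣φ[q^u+c] q B c 2≤q q⊥B q∣1+c zero
  with u , y , eq ← power≡1 q B {{>-nonZero (<-trans z<s 2≤q)}} q⊥B = u , y , eq , 1∣ _
2^∣φ[q^u+c] q B c 2≤q q⊥B q∣1+c (suc M)
  with u , y , qᵘ≡ , 2^M∣ ← 2^∣φ[q^u+c] q B c 2≤q q⊥B q∣1+c M = go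
  where
  open ≡-Reasoning
  instance
    q≢0 : NonZero q
    q≢0 = >-nonZero (<-trans z<s 2≤q)
  qᵘ A : ℕ
  qᵘ = q ^ suc u
  A  = qᵘ + c
  2≤q^ : ∀ t → 2 ≤ q ^ suc t
  2≤q^ t = ≤-trans 2≤q (m≤m*n q (q ^ t) {{m^n≢0 q t}})
  2≤A : 2 ≤ A
  2≤A = ≤-trans (2≤q^ u) (m≤m+n qᵘ c)
  instance
    A≢0 : NonZero A
    A≢0 = >-nonZero (<-trans z<s 2≤A)
    BAA≢0 : NonZero (B * (A * A))
    BAA≢0 = m*n≢0 B (A * A) {{it}} {{m*n≢0 A A}}
  q⊥A : Coprime q A
  q⊥A = coprime-^+ q u c q∣1+c
  go : ∃₂ λ u y → q ^ suc u ≡ 1 + B * y × 2 ^ suc M ∣ φ (q ^ suc u + c)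
  -- The factor `B` preserves the congruence modulo `B`. One factor `A` makes `A` divide the new
  -- value, the other makes the cofactor 1 modulo `A`, hence coprime to `A`.
  go with t , z , qᵗ≡ ← power≡1 q (B * (A * A)) (coprime-*ʳ q⊥B (coprime-*ʳ q⊥A q⊥A)) =
    u + suc t , y + qᵘ * (A * A) * z , power , subst (λ N → 2 ^ suc M ∣ φ N) (sym factor) divides-φ
    where
    w : ℕ
    w = qᵘ * B * z
    expand : q ^ suc (u + suc t) ≡ qᵘ * (1 + B * (A * A) * z)
    expand = trans (^-distribˡ-+-* q (suc u) (suc t)) (cong (qᵘ *_) qᵗ≡)
    power : q ^ suc (u + suc t) ≡ 1 + B * (y + qᵘ * (A * A) * z)
    power = begin
      q ^ suc (u + suc t)                    ≡⟨ expand ⟩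
      qᵘ * (1 + B * (A * A) * z)             ≡⟨ ring₁ qᵘ B (A * A) z ⟩
      qᵘ + B * (qᵘ * (A * A) * z)            ≡⟨ cong (_+ B * (qᵘ * (A * A) * z)) qᵘ≡ ⟩
      1 + B * y + B * (qᵘ * (A * A) * z)     ≡⟨ cong suc (sym (*-distribˡ-+ B y _)) ⟩
      1 + B * (y + qᵘ * (A * A) * z)         ∎
      where
      ring₁ : ∀ p B s z → p * (1 + B * s * z) ≡ p + B * (p * s * z)
      ring₁ = solve-∀
    factor : q ^ suc (u + suc t) + c ≡ A * (1 + A * w)
    factor = trans (cong (_+ c) expand) (ring₂ qᵘ B c z)
      where
      ring₂ : ∀ p B c z → p * (1 + B * ((p + c) * (p + c)) * z) + c
                        ≡ (p + c) * (1 + (p + c) * (p * B * z))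
      ring₂ = solve-∀
    -- `z` equal to 0 would force `q ^ suc t` to be 1. Nonzero `z` makes `w` nonzero, so `1 + A * w`
    -- is at least 3, as `φ-even` requires.
    z≢0 : z ≢ 0
    z≢0 refl = <-irrefl (sym (trans qᵗ≡ (cong suc (*-zeroʳ (B * (A * A)))))) (2≤q^ t)
    instance
      w≢0 : NonZero w
      w≢0 = m*n≢0 (qᵘ * B) z {{m*n≢0 qᵘ B {{m^n≢0 q (suc u)}}}} {{≢-nonZero z≢0}}
    divides-φ : 2 ^ suc M ∣ φ (A * (1 + A * w))
    divides-φ = subst₂ _∣_ (*-comm (2 ^ M) 2) (sym (φ-* A (1 + A * w) (coprime-1+* A w)))
      (*-pres-∣ 2^M∣ (φ-even (1 + A * w) (s≤s (≤-trans 2≤A (m≤m*n A w)))))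

φ-kernel-values : ∀ K q a b .{{_ : NonZero K}} → 2 ≤ q → Coprime q K → a < b → ∀ M →
                  ∃₂ λ n u → K * n + q ^ a ≡ q ^ suc u × 2 ^ M ∣ φ (K * n + q ^ b)
φ-kernel-values K q a b 2≤q q⊥K a<b M with δ , a+δ≡b ← m≤n⇒∃[o]m+o≡n a<b = values
  where
  open ≡-Reasoning
  instance
    q≢0 : NonZero q
    q≢0 = >-nonZero (<-trans z<s 2≤q)
  c : ℕ
  -- Since `a < b` unfolds to `suc a ≤ b`, the difference of `b` and `a` is `suc δ`; being positive,
  -- it gives `q ∣ suc c`.
  c = pred (q ^ suc δ)
  1+c≡ : suc c ≡ q ^ suc δ
  1+c≡ = suc-pred (q ^ suc δ) {{m^n≢0 q (suc δ)}}
  q∣1+c : q ∣ suc c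
  q∣1+c = subst (q ∣_) (sym 1+c≡) (m∣m*n (q ^ δ))
  values : ∃₂ λ n u → K * n + q ^ a ≡ q ^ suc u × 2 ^ M ∣ φ (K * n + q ^ b)
  values with u , y , qᵘ≡ , 2^M∣ ← 2^∣φ[q^u+c] q K c 2≤q q⊥K q∣1+c M =
    -- With `K * y` equal to `q ^ suc u - 1`, this `n` makes `q ^ a` a common factor of both
    -- arguments.
    q ^ a * y , a + u , first ,
    subst (2 ^ M ∣_) (sym (trans (cong φ second) (φ-* (q ^ a) A qᵃ⊥A))) (∣n⇒∣m*n (φ (q ^ a)) 2^M∣)
    where
    A : ℕ
    A = q ^ suc u + c
    instance
      A≢0 : NonZero A
      A≢0 = >-nonZero (≤-trans (m^n>0 q (suc u)) (m≤m+n _ c))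
      qᵃ≢0 : NonZero (q ^ a)
      qᵃ≢0 = m^n≢0 q a
    first : K * (q ^ a * y) + q ^ a ≡ q ^ suc (a + u)
    first = begin
      K * (q ^ a * y) + q ^ a  ≡⟨ ring₁ K (q ^ a) y ⟩
      q ^ a * (1 + K * y)      ≡⟨ cong (q ^ a *_) (sym qᵘ≡) ⟩
      q ^ a * q ^ suc u        ≡⟨ sym (^-distribˡ-+-* q a (suc u)) ⟩
      q ^ (a + suc u)          ≡⟨ cong (q ^_) (+-suc a u) ⟩
      q ^ suc (a + u)          ∎
      where
      ring₁ : ∀ K p y → K * (p * y) + p ≡ p * (1 + K * y)
      ring₁ = solve-∀
    second : K * (q ^ a * y) + q ^ b ≡ q ^ a * A
    second = begin
      K * (q ^ a * y) + q ^ b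
        ≡⟨ cong (λ e → K * (q ^ a * y) + q ^ e) (trans (sym a+δ≡b) (sym (+-suc a δ))) ⟩
      K * (q ^ a * y) + q ^ (a + suc δ)
        ≡⟨ cong (K * (q ^ a * y) +_) (^-distribˡ-+-* q a (suc δ)) ⟩
      K * (q ^ a * y) + q ^ a * q ^ suc δ
        ≡⟨ cong (λ p → K * (q ^ a * y) + q ^ a * p) (sym 1+c≡) ⟩
      K * (q ^ a * y) + q ^ a * (1 + c)
        ≡⟨ ring₂ K (q ^ a) y c ⟩
      q ^ a * (1 + K * y + c)
        ≡⟨ cong (λ p → q ^ a * (p + c)) (sym qᵘ≡) ⟩
      q ^ a * A ∎
      where
      ring₂ : ∀ K p y c → K * (p * y) + p * (1 + c) ≡ p * (1 + K * y + c)
      ring₂ = solve-∀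
    qᵃ⊥A : Coprime (q ^ a) A
    qᵃ⊥A = coprime-sym (coprime-^ʳ (coprime-sym (coprime-^+ q u c q∣1+c)) a)

-- As `q ^ u` is odd, `2 ^ q` would have to divide `φ q`, but `φ q` is positive and at most `q`,
-- which is below `2 ^ q`.
2^q∤φ[q^1+u] : ∀ q u .{{_ : NonZero q}} → Coprime 2 q → ¬ 2 ^ q ∣ φ (q ^ suc u)
2^q∤φ[q^1+u] q u 2⊥q 2^q∣ =
  <⇒≱ (n<m^n 2 q ≤-refl) (≤-trans (∣⇒≤ {{>-nonZero (φ>0 q)}} 2^q∣φq) (φ≤n q))
  where
  2^q∣φq : 2 ^ q ∣ φ q
  2^q∣φq = coprime-divisor (coprime-sym (coprime-^ʳ (coprime-sym (coprime-^ʳ 2⊥q u)) q))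
    (subst (2 ^ q ∣_) (φ-^ q u) 2^q∣)

-- Regular sequences modulo m

%ℕ≡⇒∣- : ∀ m .{{_ : NonZero m}} i j → i ℤ.%ℕ m ≡ j ℤ.%ℕ m → ℤ.+ m ℤ∣.∣ i ℤ.- j
%ℕ≡⇒∣- m i j eq = ℤ∣.divides (i ℤ./ℕ m ℤ.- j ℤ./ℕ m) (begin
  i ℤ.- j
    ≡⟨ cong₂ ℤ._-_ (ℤ.a≡a%ℕn+[a/ℕn]*n i m) (ℤ.a≡a%ℕn+[a/ℕn]*n j m) ⟩
  (ℤ.+ (i ℤ.%ℕ m) ℤ.+ i ℤ./ℕ m ℤ.* ℤ.+ m) ℤ.- (ℤ.+ (j ℤ.%ℕ m) ℤ.+ j ℤ./ℕ m ℤ.* ℤ.+ m)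
    ≡⟨ cong (λ r → (ℤ.+ r ℤ.+ i ℤ./ℕ m ℤ.* ℤ.+ m) ℤ.- (ℤ.+ (j ℤ.%ℕ m) ℤ.+ j ℤ./ℕ m ℤ.* ℤ.+ m)) eq ⟩
  (ℤ.+ (j ℤ.%ℕ m) ℤ.+ i ℤ./ℕ m ℤ.* ℤ.+ m) ℤ.- (ℤ.+ (j ℤ.%ℕ m) ℤ.+ j ℤ./ℕ m ℤ.* ℤ.+ m)
    ≡⟨ cancel (ℤ.+ (j ℤ.%ℕ m)) (i ℤ./ℕ m) (j ℤ./ℕ m) (ℤ.+ m) ⟩
  (i ℤ./ℕ m ℤ.- j ℤ./ℕ m) ℤ.* ℤ.+ m ∎)
  where
  open ≡-Reasoning
  cancel : ∀ r a b m → (r ℤ.+ a ℤ.* m) ℤ.- (r ℤ.+ b ℤ.* m) ≡ (a ℤ.- b) ℤ.* m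
  cancel = ℤSolver.solve-∀

lincomb-∣- : ∀ {m} d (c c′ : Fin d → ℤ.ℤ) t n → (∀ i → m ℤ∣.∣ c i ℤ.- c′ i) →
             m ℤ∣.∣ lincomb d c t n ℤ.- lincomb d c′ t n
lincomb-∣- {m} zero    c c′ t n m∣ = ℤ∣.divides (ℤ.+ 0) refl
lincomb-∣- {m} (suc d) c c′ t n m∣ = subst (m ℤ∣.∣_)
  (sym (regroup (c Fin.zero) (c′ Fin.zero) (t Fin.zero n) _ _))
  (ℤ∣.∣m∣n⇒∣m+n (ℤ∣.∣m⇒∣m*n (t Fin.zero n) (m∣ Fin.zero))
    (lincomb-∣- d (c ∘ Fin.suc) (c′ ∘ Fin.suc) (t ∘ Fin.suc) n (m∣ ∘ Fin.suc)))
  where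
  regroup : ∀ a b t x y → (a ℤ.* t ℤ.+ x) ℤ.- (b ℤ.* t ℤ.+ y) ≡ (a ℤ.- b) ℤ.* t ℤ.+ (x ℤ.- y)
  regroup = ℤSolver.solve-∀

-- Modulo `m` there are only `m ^ d` coefficient vectors, so two of any `m ^ d + 1` kernel sequences
-- agree. The bound `D` comes before `l` and `r`, so `l` may be chosen large in terms of `D`.
regular-mod : ∀ {k s} → IsRegular k s → ∀ m .{{_ : NonZero m}} →
  ∃ λ D → ∀ l (r : ℕ → ℕ) → (∀ a → a ≤ D → r a < k ^ l) →
  ∃₂ λ a b → a < b × ∀ n → ℤ.+ m ℤ∣.∣ s (k ^ l * n + r a) ℤ.- s (k ^ l * n + r b)
regular-mod {k} {s} (d , t , span) m = m ^ d , collide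
  where
  collide : ∀ l (r : ℕ → ℕ) → (∀ a → a ≤ m ^ d → r a < k ^ l) →
    ∃₂ λ a b → a < b × ∀ n → ℤ.+ m ℤ∣.∣ s (k ^ l * n + r a) ℤ.- s (k ^ l * n + r b)
  collide l r r< = collision
    where
    open ≡-Reasoning
    kernel : (a : Fin (suc (m ^ d))) →
             ∃ λ c → ∀ n → s (k ^ l * n + r (toℕ a)) ≡ lincomb d c t n
    kernel a = span l (r (toℕ a)) (r< (toℕ a) (≤-pred (toℕ<n a)))
    coeff : Fin (suc (m ^ d)) → Fin d → ℤ.ℤ
    coeff a = proj₁ (kernel a)
    spans : ∀ a n → s (k ^ l * n + r (toℕ a)) ≡ lincomb d (coeff a) t n
    spans a = proj₂ (kernel a)
    residue : ℤ.ℤ → Fin m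
    residue c = fromℕ< (ℤ.n%ℕd<d c m)
    -- The vector of residues is encoded as one number below `m ^ d`, ready for the pigeonhole
    -- principle.
    code : Fin (suc (m ^ d)) → Fin (m ^ d)
    code a = funToFin (residue ∘ coeff a)
    same : ∀ i j → code i ≡ code j → ∀ e → coeff i e ℤ.%ℕ m ≡ coeff j e ℤ.%ℕ m
    same i j eq e = begin
      coeff i e ℤ.%ℕ m          ≡⟨ sym (toℕ-fromℕ< _) ⟩
      toℕ (residue (coeff i e)) ≡⟨ cong toℕ (sym (finToFun-funToFin (residue ∘ coeff i) e)) ⟩
      toℕ (finToFun (code i) e) ≡⟨ cong (λ c → toℕ (finToFun c e)) eq ⟩
      toℕ (finToFun (code j) e) ≡⟨ cong toℕ (finToFun-funToFin (residue ∘ coeff j) e) ⟩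
      toℕ (residue (coeff j e)) ≡⟨ toℕ-fromℕ< _ ⟩
      coeff j e ℤ.%ℕ m          ∎
    collision : ∃₂ λ a b → a < b × ∀ n → ℤ.+ m ℤ∣.∣ s (k ^ l * n + r a) ℤ.- s (k ^ l * n + r b)
    collision with i , j , i<j , eq ← pigeonhole (n<1+n (m ^ d)) code =
      toℕ i , toℕ j , i<j , λ n →
        subst (ℤ.+ m ℤ∣.∣_) (sym (cong₂ ℤ._-_ (spans i n) (spans j n)))
          (lincomb-∣- d (coeff i) (coeff j) t n
            (λ e → %ℕ≡⇒∣- m (coeff i e) (coeff j e) (same i j eq e)))

+∣-∣⇒∣ : ∀ m x y → ℤ.+ m ℤ∣.∣ ℤ.+ x ℤ.- ℤ.+ y → m ∣ y → m ∣ x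
+∣-∣⇒∣ m x y m∣x-y m∣y = ℤ∣.∣⇒∣ᵤ {ℤ.+ m} {ℤ.+ x}
  (ℤ∣.∣m+n∣n⇒∣m m∣x-y (ℤ∣.∣m⇒∣-m (ℤ∣.∣ᵤ⇒∣ {ℤ.+ m} {ℤ.+ y} m∣y)))

regular-∣ : ∀ {k} {s : ℕ → ℕ} → IsRegular k (λ n → ℤ.+ s n) → ∀ m .{{_ : NonZero m}} →
  ∃ λ D → ∀ l (r : ℕ → ℕ) → (∀ a → a ≤ D → r a < k ^ l) →
  ∃₂ λ a b → a < b × ∀ n → m ∣ s (k ^ l * n + r b) → m ∣ s (k ^ l * n + r a)
regular-∣ {k} {s} regular m with D , collide ← regular-mod {k} {λ n → ℤ.+ s n} regular m =
  D , λ l r r< → let a , b , a<b , agree = collide l r r< in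
    a , b , a<b , λ n → +∣-∣⇒∣ m (s (k ^ l * n + r a)) (s (k ^ l * n + r b)) (agree n)

-- Coprimality of `q` to `k` yields powers of `q` that are 1 modulo `k ^ l`; oddness of `q` keeps
-- the power of 2 in `φ (q ^ suc u)` bounded.
φ-not-regular : ∀ k q → 2 ≤ k → 2 ≤ q → Coprime q k → Coprime 2 q → ¬ IsRegular k φseq
φ-not-regular k q 2≤k 2≤q q⊥k 2⊥q regular =
  let instance
        k≢0 : NonZero k
        k≢0 = >-nonZero (<-trans z<s 2≤k)
        q≢0 : NonZero q
        q≢0 = >-nonZero (<-trans z<s 2≤q)
      D , collide = regular-∣ {k} {φ} regular (2 ^ q) {{m^n≢0 2 q}}
      -- Any `a ≤ D` then satisfies `q ^ a ≤ l < k ^ l`, so each `q ^ a` is an admissible remainder.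
      l = q ^ D
      a , b , a<b , agree = collide l (q ^_)
        (λ a a≤D → ≤-<-trans (^-monoʳ-≤ q a≤D) (n<m^n k l 2≤k))
      n , u , first , 2^q∣second =
        φ-kernel-values (k ^ l) q a b {{m^n≢0 k l}} 2≤q (coprime-^ʳ q⊥k l) a<b q
  in 2^q∤φ[q^1+u] q u 2⊥q (subst (λ N → 2 ^ q ∣ φ N) first (agree n 2^q∣second))

theorem3p3 : (k : ℕ) → 2 ≤ k → ¬ IsRegular k φseq
-- The number `1 + k * 2` is 1 modulo both `k` and 2, hence coprime to each.
theorem3p3 k 2≤k = φ-not-regular k (1 + k * 2) 2≤k
  (≤-trans 2≤k (≤-trans (m≤m*n k 2) (n≤1+n (k * 2))))
  (coprime-sym (coprime-1+* k 2))
  (subst (λ i → Coprime 2 (suc i)) (*-comm 2 k) (coprime-1+* 2 k))
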